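{- Let $b\ge 2$ and let $S$ be a standard skew tableau with $b$ rows whose row sizes are weakly decreasing from top to bottom. Then $S$ stabilizes at $2b-2$.
   Context: Tableaux use English notation. A standard skew tableau $S$ of size $m$ is a filling of the cells of a skew shape $\lambda/\mu$ with $1,\dots,m$, each used once, increasing left to right along rows and top to bottom down columns. $S+x$ denotes $S$ with $x$ added to every entry. $\mathrm{Rect}(S)$ is the rectification of $S$ by Schützenberger's jeu de taquin (perform inner slides until a straight shape is reached; the result is independent of choices), equivalently the Schensted row-insertion tableau of the reading word of $S$ (entries read left to right in each row, rows from bottom to top). For $S$ standard of size $m$ with row sizes weakly decreasing from top to bottom and $k\ge1$, $S^{(k)}$ is the standard skew tableau whose $i$-th row (from the top) consists of the cells of the $i$-th row of $S$ followed immediately to their right by the $i$-th rows of $S+m,S+2m,\dots,S+(k-1)m$, in this order. $S$ stabilizes at $k$ if every entry in $[(k-1)m+1,km]$ lies in the same row (counted from the top) of $\mathrm{Rect}(S^{(k)})$ as in $S^{(k)}$. -}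

module Defs where

open import Data.Nat using (ℕ; zero; suc; _+_; _*_; _∸_; _≤_; _<_; _<?_; _≟_)
open import Data.Nat.Properties using ()
open import Data.List using (List; []; _∷_; _++_; length; map; concat; reverse; foldl; upTo; sum)
open import Data.List.Relation.Unary.Linked using (Linked)
open import Data.List.Relation.Unary.All using (All)
open import Data.List.Relation.Binary.Permutation.Propositional using (_↭_)
open import Data.Maybe using (Maybe; just; nothing)
open import Data.Product using (_×_; _,_; proj₁; proj₂)
open import Relation.Nullary using (yes; no)
open import Relation.Binary.PropositionalEquality using (_≡_)

-- A skew tableau is a list of rows, top to bottom (English notation).
-- Each row is (μᵢ , entries): the row occupies columns μᵢ, μᵢ+1, …, μᵢ + length entries − 1
-- (columns counted from 0).  So the shape is λ/μ with λᵢ = μᵢ + length entries.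
Row : Set
Row = ℕ × List ℕ

SkewTableau : Set
SkewTableau = List Row

rowSize : Row → ℕ
rowSize (_ , r) = length r

outer : Row → ℕ
outer (μ , r) = μ + length r

entries : SkewTableau → List ℕ
entries S = concat (map proj₂ S)

size : SkewTableau → ℕ
size S = length (entries S)

lookupL : List ℕ → ℕ → Maybe ℕ
lookupL []       _       = nothing
lookupL (x ∷ xs) zero    = just x
lookupL (x ∷ xs) (suc n) = lookupL xs n

entryAt : Row → ℕ → Maybe ℕ
entryAt (μ , r) c with c <? μ
... | yes _ = nothing
... | no  _ = lookupL r (c ∸ μ)

AdjacentRows : Row → Row → Set
AdjacentRows up lo =
  (proj₁ lo ≤ proj₁ up) × (outer lo ≤ outer up) ×
  (∀ c x y → entryAt up c ≡ just x → entryAt lo c ≡ just y → x < y)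

IsStandardSkew : SkewTableau → Set
IsStandardSkew S =
  All (λ row → Linked _<_ (proj₂ row)) S ×
  Linked AdjacentRows S ×
  (entries S ↭ map suc (upTo (size S)))

RowSizesWeaklyDecreasing : SkewTableau → Set
RowSizesWeaklyDecreasing S = Linked (λ up lo → rowSize lo ≤ rowSize up) S

-- Every row is nonempty (so "S has b rows" means length S ≡ b).
AllRowsNonempty : SkewTableau → Set
AllRowsNonempty S = All (λ row → 1 ≤ rowSize row) S

shift : ℕ → SkewTableau → SkewTableau
shift x S = map (λ row → proj₁ row , map (_+ x) (proj₂ row)) S

power : SkewTableau → ℕ → SkewTableau
power S k = map (λ row → proj₁ row , concat (map (λ j → map (_+ (j * m)) (proj₂ row)) (upTo k))) S
  where m = size S

insertRow : ℕ → List ℕ → Maybe ℕ × List ℕ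
insertRow x [] = nothing , x ∷ []
insertRow x (y ∷ ys) with x <? y
... | yes _ = just y , x ∷ ys
... | no  _ with insertRow x ys
...   | (bumped , ys') = bumped , y ∷ ys'

insertT : ℕ → List (List ℕ) → List (List ℕ)
insertT x [] = (x ∷ []) ∷ []
insertT x (r ∷ rs) with insertRow x r
... | (nothing , r') = r' ∷ rs
... | (just y , r')  = r' ∷ insertT y rs

readingWord : SkewTableau → List ℕ
readingWord S = concat (reverse (map proj₂ S))

Rect : SkewTableau → List (List ℕ)
Rect S = foldl (λ T x → insertT x T) [] (readingWord S)

rowIndex : ℕ → List (List ℕ) → Maybe ℕ
rowIndex x [] = nothing
rowIndex x (r ∷ rs) with Data.List.Relation.Unary.Any.any? (x ≟_) r
  where import Data.List.Relation.Unary.Any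
... | yes _ = just zero
... | no  _ = Data.Maybe.map suc (rowIndex x rs)

StabilizesAt : SkewTableau → ℕ → Set
StabilizesAt S k =
  ∀ x → suc ((k ∸ 1) * size S) ≤ x → x ≤ k * size S →
  rowIndex x (Rect (power S k)) ≡ rowIndex x (map proj₂ (power S k))

{-# OPTIONS --safe #-}

-- Rows are compared through counting functions: count t xs is the number of
-- entries of xs that are at most t.  Inserting an increasing word w into a row r
-- bumps some entries b of r and keeps the others, the survivors v.  Each bumped
-- entry is matched with a smaller entry of w, and an entry survives only if all
-- smaller entries of w are already matched.  If, from P on, w and r grow like two
-- rows of S^(k), the row of w being at least as long, then a survivor beyond P + m
-- would contradict the matching one period earlier.  So beyond P + m the new row
-- grows like w and the bumped word like r: each insertion costs one period.
-- After j rows have been inserted, row i of the tableau is therefore correct beyond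
-- (j - 1 + i) m, and the last row, which is created by the bumped word, is correct
-- beyond (2j - 3) m.
module Submission where

open import Defs
open import Data.Empty using (⊥-elim)
open import Data.List using (List; []; _∷_; _++_; _∷ʳ_; length; map; concat; reverse; foldl; upTo; applyUpTo)
open import Data.List.Properties using (map-++; map-∘; length-map; length-++; unfold-reverse; concat-++; ++-identityʳ; foldl-++; map-upTo; applyUpTo-∷ʳ)
open import Data.List.Relation.Binary.Permutation.Propositional using (↭-sym)
open import Data.List.Relation.Binary.Permutation.Propositional.Properties using (All-resp-↭)
open import Data.List.Relation.Unary.All as All using (All; []; _∷_)
import Data.List.Relation.Unary.All.Properties as All
open import Data.List.Relation.Unary.AllPairs as AllPairs using (AllPairs; []; _∷_)
import Data.List.Relation.Unary.AllPairs.Properties as AllPairs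
open import Data.List.Relation.Unary.Any using (Any; here; there; any?)
open import Data.List.Relation.Unary.Linked as Linked using (Linked; []; [-]; _∷_)
import Data.List.Relation.Unary.Linked.Properties as Linked
import Data.Maybe as Maybe
open import Data.Nat using (ℕ; zero; suc; _+_; _*_; _∸_; _≤_; _<_; z≤n; s≤s; _<?_; _≤?_; _≟_)
open import Data.Nat.ListAction using (sum)
open import Data.Nat.ListAction.Properties using (sum-++)
open import Data.Nat.Properties
open import Data.Nat.Solver using (module +-*-Solver)
open import Data.Product using (_×_; _,_; proj₁; proj₂; ∃)
open import Data.Sum using (_⊎_; inj₁; inj₂)
open import Function using (_∘_)
open import Relation.Binary.Definitions using (tri<; tri≈; tri>)
open import Relation.Binary.PropositionalEquality using (_≡_; refl; sym; trans; cong; cong₂; subst; subst₂; module ≡-Reasoning)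
open import Relation.Nullary using (yes; no)

open +-*-Solver using (solve; _:+_; _:=_)

-- Counting functions of words

Sorted : List ℕ → Set
Sorted = AllPairs _≤_

-- Truncated subtraction makes this 1 if x ≤ t and 0 otherwise.
atMost : ℕ → ℕ → ℕ
atMost t x = 1 ∸ (x ∸ t)

count : ℕ → List ℕ → ℕ
count t xs = sum (map (atMost t) xs)

atMost-mono : ∀ {t u x y} → t ≤ u → x ≤ y → atMost t y ≤ atMost u x
atMost-mono t≤u x≤y = ∸-monoʳ-≤ 1 (∸-mono x≤y t≤u)

atMost-yes : ∀ {t x} → x ≤ t → atMost t x ≡ 1
atMost-yes x≤t = cong (1 ∸_) (m≤n⇒m∸n≡0 x≤t)

atMost-no : ∀ {t x} → t < x → atMost t x ≡ 0
atMost-no t<x = m≤n⇒m∸n≡0 (m<n⇒0<n∸m t<x)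

atMost-suc : ∀ t x → suc t ≡ x ⊎ atMost (suc t) x ≡ atMost t x
atMost-suc t x with <-cmp (suc t) x
... | tri≈ _ eq _ = inj₁ eq
... | tri< lt _ _ = inj₂ (trans (atMost-no lt) (sym (atMost-no (<-trans (n<1+n t) lt))))
... | tri> _ _ (s≤s x≤t) = inj₂ (trans (atMost-yes (m≤n⇒m≤1+n x≤t)) (sym (atMost-yes x≤t)))

count-mono : ∀ {t u} xs → t ≤ u → count t xs ≤ count u xs
count-mono []       t≤u = z≤n
count-mono (x ∷ xs) t≤u = +-mono-≤ (atMost-mono t≤u (≤-refl {x})) (count-mono xs t≤u)

count-none : ∀ {t xs} → All (t <_) xs → count t xs ≡ 0
count-none []         = refl
count-none (lt ∷ lts) = cong₂ _+_ (atMost-no lt) (count-none lts)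

count-all : ∀ {t xs} → All (_≤ t) xs → count t xs ≡ length xs
count-all []         = refl
count-all (le ∷ les) = cong₂ _+_ (atMost-yes le) (count-all les)

count-++ : ∀ t xs ys → count t (xs ++ ys) ≡ count t xs + count t ys
count-++ t xs ys = trans (cong sum (map-++ (atMost t) xs ys)) (sum-++ (map (atMost t) xs) _)

-- Entries are read off from jumps of the counting function; this and `count<⇒∈` carry results about
-- counts back to membership in rows.
∈⇒count< : ∀ {t xs} → Any (suc t ≡_) xs → count t xs < count (suc t) xs
∈⇒count< {t} {x ∷ xs} (here refl) = +-mono-<-≤
  (subst₂ _<_ (sym (atMost-no (n<1+n t))) (sym (atMost-yes (≤-refl {suc t}))) (n<1+n 0))
  (count-mono xs (n≤1+n t))
∈⇒count< {t} {x ∷ xs} (there p) = +-mono-≤-< (atMost-mono (n≤1+n t) (≤-refl {x})) (∈⇒count< p)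

count<⇒∈ : ∀ {t} xs → count t xs < count (suc t) xs → Any (suc t ≡_) xs
count<⇒∈ {t} (x ∷ xs) lt with atMost-suc t x
... | inj₁ eq = here eq
... | inj₂ eq = there (count<⇒∈ xs (+-cancelˡ-< (atMost t x) _ _
        (subst (λ z → count t (x ∷ xs) < z + count (suc t) xs) eq lt)))

-- Insertion of words into a row

-- Insertion w r b v n: inserting the increasing word w into the row r bumps b,
-- leaves the survivors v of r in place, and produces the row n.
data Insertion : (w r b v n : List ℕ) → Set where
  done   : ∀ {r} → Insertion [] r [] r r
  append : ∀ {w} → Insertion w [] [] [] w
  bump   : ∀ {x xs y ys b v n} → x < y → Insertion xs ys b v n →
           Insertion (x ∷ xs) (y ∷ ys) (y ∷ b) v (x ∷ n)
  skip   : ∀ {x xs y ys b v n} → y ≤ x → Insertion (x ∷ xs) ys b v n →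
           Insertion (x ∷ xs) (y ∷ ys) b (y ∷ v) (y ∷ n)

insertion : ∀ w r → ∃ λ b → ∃ λ v → ∃ λ n → Insertion w r b v n
insertion []       r        = _ , _ , _ , done
insertion (x ∷ xs) []       = _ , _ , _ , append
insertion (x ∷ xs) (y ∷ ys) with x <? y
... | yes x<y = _ , _ , _ , bump x<y (proj₂ (proj₂ (proj₂ (insertion xs ys))))
... | no  x≮y = _ , _ , _ , skip (≮⇒≥ x≮y) (proj₂ (proj₂ (proj₂ (insertion (x ∷ xs) ys))))

module _ {P : ℕ → Set} where

  All-bumped : ∀ {w r b v n} → Insertion w r b v n → All P r → All P b
  All-bumped done         pr       = []
  All-bumped append       pr       = []
  All-bumped (bump _ ins) (p ∷ pr) = p ∷ All-bumped ins pr
  All-bumped (skip _ ins) (_ ∷ pr) = All-bumped ins pr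

  All-survivors : ∀ {w r b v n} → Insertion w r b v n → All P r → All P v
  All-survivors done         pr       = pr
  All-survivors append       pr       = []
  All-survivors (bump _ ins) (_ ∷ pr) = All-survivors ins pr
  All-survivors (skip _ ins) (p ∷ pr) = p ∷ All-survivors ins pr

  All-newRow : ∀ {w r b v n} → Insertion w r b v n → All P w → All P r → All P n
  All-newRow done         pw       pr       = pr
  All-newRow append       pw       pr       = pw
  All-newRow (bump _ ins) (p ∷ pw) (_ ∷ pr) = p ∷ All-newRow ins pw pr
  All-newRow (skip _ ins) pw       (p ∷ pr) = p ∷ All-newRow ins pw pr

bumped-sorted : ∀ {w r b v n} → Insertion w r b v n → Sorted r → Sorted b
bumped-sorted done         _          = []
bumped-sorted append       _          = []
bumped-sorted (bump _ ins) (y≤ ∷ sr) = All-bumped ins y≤ ∷ bumped-sorted ins sr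
bumped-sorted (skip _ ins) (_  ∷ sr) = bumped-sorted ins sr

newRow-sorted : ∀ {w r b v n} → Insertion w r b v n → Sorted w → Sorted r → Sorted n
newRow-sorted done   _  sr = sr
newRow-sorted append sw _  = sw
newRow-sorted (bump x<y ins) (x≤ ∷ sw) (y≤ ∷ sr) =
  All-newRow ins x≤ (All.map (≤-trans (<⇒≤ x<y)) y≤) ∷ newRow-sorted ins sw sr
newRow-sorted (skip y≤x ins) sw@(x≤ ∷ _) (y≤ ∷ sr) =
  All-newRow ins (y≤x ∷ All.map (≤-trans y≤x) x≤) y≤ ∷ newRow-sorted ins sw sr

count-newRow : ∀ {w r b v n} t → Insertion w r b v n → count t n ≡ count t w + count t v
count-newRow t done   = refl
count-newRow {w} t append = sym (+-identityʳ (count t w))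
count-newRow {x ∷ xs} {v = v} t (bump _ ins) =
  trans (cong (atMost t x +_) (count-newRow t ins)) (sym (+-assoc (atMost t x) (count t xs) (count t v)))
count-newRow {w} {y ∷ _} {v = _ ∷ v} t (skip _ ins) =
  trans (cong (atMost t y +_) (count-newRow t ins))
    (solve 3 (λ p q s → p :+ (q :+ s) := q :+ (p :+ s)) refl (atMost t y) (count t w) (count t v))

count-oldRow : ∀ {w r b v n} t → Insertion w r b v n → count t r ≡ count t b + count t v
count-oldRow t done   = refl
count-oldRow t append = refl
count-oldRow {_} {y ∷ _} {_ ∷ b} {v} t (bump _ ins) =
  trans (cong (atMost t y +_) (count-oldRow t ins)) (sym (+-assoc (atMost t y) (count t b) (count t v)))
count-oldRow {_} {y ∷ _} {b} {_ ∷ v} t (skip _ ins) =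
  trans (cong (atMost t y +_) (count-oldRow t ins))
    (solve 3 (λ p q s → p :+ (q :+ s) := q :+ (p :+ s)) refl (atMost t y) (count t b) (count t v))

-- Each bump pairs a bumped `y` with some `x < y` from `w`; strictness gains the step from `t` to
-- `suc t`.
bumped-matched : ∀ {w r b v n} t → Insertion w r b v n → count (suc t) b ≤ count t w
bumped-matched t done   = z≤n
bumped-matched t append = z≤n
bumped-matched t (bump x<y ins) = +-mono-≤ (atMost-mono (≤-refl {suc t}) x<y) (bumped-matched t ins)
bumped-matched t (skip _ ins)   = bumped-matched t ins

-- When `suc t` survives, the letters of `w` still to be inserted are at least `suc t`. So each
-- letter up to `t` has already bumped an entry, which lies to the left of the survivor.
survives⇒all-matched : ∀ {w r b v n} t → Insertion w r b v n → Sorted w → Sorted r →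
  count (suc t) v ≤ count t v ⊎ count t w ≤ count (suc t) b
survives⇒all-matched t done   _ _ = inj₂ z≤n
survives⇒all-matched t append _ _ = inj₁ z≤n
survives⇒all-matched {x ∷ _} {y ∷ _} t (bump _ ins) (_ ∷ sw) (y≤ ∷ sr)
  with survives⇒all-matched t ins sw sr | y ≤? suc t
... | inj₁ le | _       = inj₁ le
... | inj₂ le | yes y≤t = inj₂ (+-mono-≤
        (≤-trans (m∸n≤m 1 (x ∸ t)) (≤-reflexive (sym (atMost-yes y≤t)))) le)
-- `y` exceeds `suc t` and the row is sorted, so every later survivor exceeds it too.
... | inj₂ le | no  y≰t = inj₁ (≤-trans (≤-reflexive (count-none
        (All-survivors ins (All.map (<-≤-trans (≰⇒> y≰t)) y≤)))) z≤n)
survives⇒all-matched {x ∷ xs} {y ∷ _} t (skip y≤x ins) sw@(x≤ ∷ _) (_ ∷ sr)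
  with atMost-suc t y | survives⇒all-matched t ins sw sr
... | inj₁ refl | _       = inj₂ (≤-trans (≤-reflexive
        (count-none {t} {x ∷ xs} (y≤x ∷ All.map (≤-trans y≤x) x≤))) z≤n)
... | inj₂ eq   | inj₁ le = inj₁ (+-mono-≤ (≤-reflexive eq) le)
... | inj₂ _    | inj₂ le = inj₂ le

-- Insertion of words into a tableau

insertAll : List (List ℕ) → List ℕ → List (List ℕ)
insertAll = foldl (λ T x → insertT x T)

-- The empty tableau gets an empty first row, so a row not yet created is handled like an existing
-- one.
firstRow : List (List ℕ) → List ℕ
firstRow []      = []
firstRow (r ∷ T) = r

otherRows : List (List ℕ) → List (List ℕ)
otherRows []      = []
otherRows (r ∷ T) = T

infixr 5 _∷ʰ_
_∷ʰ_ : ℕ → List (List ℕ) → List (List ℕ)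
y ∷ʰ T = (y ∷ firstRow T) ∷ otherRows T

-- A letter `x ≥ y` passes a leading `y` without bumping it, so this `y` can be set aside during the
-- insertion.
insertT-∷ʰ : ∀ {x y} T → y ≤ x → insertT x (y ∷ʰ T) ≡ y ∷ʰ insertT x T
insertT-∷ʰ {x} {y} [] y≤x with x <? y
... | yes x<y = ⊥-elim (<⇒≱ x<y y≤x)
... | no  _   = refl
insertT-∷ʰ {x} {y} (r ∷ T) y≤x with x <? y
... | yes x<y = ⊥-elim (<⇒≱ x<y y≤x)
... | no  _   with insertRow x r
...   | (Maybe.nothing , _) = refl
...   | (Maybe.just _  , _) = refl

insertAll-∷ʰ : ∀ {y} T w → All (y ≤_) w → insertAll (y ∷ʰ T) w ≡ y ∷ʰ insertAll T w
insertAll-∷ʰ T []      _          = refl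
insertAll-∷ʰ T (x ∷ w) (y≤x ∷ y≤) =
  trans (cong (λ U → insertAll U w) (insertT-∷ʰ T y≤x)) (insertAll-∷ʰ (insertT x T) w y≤)

insertT-bump : ∀ {x y} r T → x < y → insertT x ((y ∷ r) ∷ T) ≡ x ∷ʰ r ∷ insertT y T
insertT-bump {x} {y} r T x<y with x <? y
... | yes _   = refl
... | no  x≮y = ⊥-elim (x≮y x<y)

insertAll-[] : ∀ w T → Sorted w → insertAll ([] ∷ T) w ≡ w ∷ T
insertAll-[] []      T _         = refl
insertAll-[] (x ∷ w) T (x≤ ∷ sw) =
  trans (insertAll-∷ʰ ([] ∷ T) w x≤) (cong (x ∷ʰ_) (insertAll-[] w T sw))

-- After each step the front entry is at most every remaining letter of the sorted word, so it stays
-- in place. The bumped entries enter `T` in the order of `b`, and nothing else reaches `T`.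
insertAll-∷ : ∀ {w r b v n} T → Insertion w r b v n → Sorted w →
  insertAll (r ∷ T) w ≡ n ∷ insertAll T b
insertAll-∷     T done   _  = refl
insertAll-∷ {w} T append sw = insertAll-[] w T sw
insertAll-∷ {x ∷ w} {y ∷ r} {_ ∷ b} {_} {_ ∷ n} T (bump x<y ins) (x≤ ∷ sw) = begin
  insertAll (insertT x ((y ∷ r) ∷ T)) w  ≡⟨ cong (λ U → insertAll U w) (insertT-bump r T x<y) ⟩
  insertAll (x ∷ʰ r ∷ insertT y T) w     ≡⟨ insertAll-∷ʰ (r ∷ insertT y T) w x≤ ⟩
  x ∷ʰ insertAll (r ∷ insertT y T) w     ≡⟨ cong (x ∷ʰ_) (insertAll-∷ (insertT y T) ins sw) ⟩
  (x ∷ n) ∷ insertAll (insertT y T) b    ∎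
  where open ≡-Reasoning
insertAll-∷ {w@(x ∷ _)} {y ∷ r} T (skip y≤x ins) sw@(x≤ ∷ _) =
  trans (insertAll-∷ʰ (r ∷ T) w (y≤x ∷ All.map (≤-trans y≤x) x≤))
        (cong (y ∷ʰ_) (insertAll-∷ T ins sw))

insertAll-firstRow : ∀ {w b v n} T → Insertion w (firstRow T) b v n → Sorted w →
  firstRow (insertAll T w) ≡ n
insertAll-firstRow (r ∷ T) ins sw = cong firstRow (insertAll-∷ T ins sw)
insertAll-firstRow {[]}    [] done   sw = refl
insertAll-firstRow {[]}    [] append sw = refl
-- The letter `x` has the same effect on the empty tableau as on a single empty row.
insertAll-firstRow {x ∷ w} [] append sw = cong firstRow (insertAll-[] (x ∷ w) [] sw)

insertAll-otherRows : ∀ {w b v n} T → Insertion w (firstRow T) b v n → Sorted w →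
  otherRows (insertAll T w) ≡ insertAll (otherRows T) b
insertAll-otherRows (r ∷ T) ins sw = cong otherRows (insertAll-∷ T ins sw)
insertAll-otherRows {[]}    [] done   sw = refl
insertAll-otherRows {[]}    [] append sw = refl
insertAll-otherRows {x ∷ w} [] append sw = cong otherRows (insertAll-[] (x ∷ w) [] sw)

rect : List (List ℕ) → List (List ℕ)
rect as = insertAll [] (concat (reverse as))

-- The reading word runs from bottom to top, so the top row is inserted last; this permits induction
-- over the rows.
rect-∷ : ∀ a as → rect (a ∷ as) ≡ insertAll (rect as) a
rect-∷ a as = begin
  insertAll [] (concat (reverse (a ∷ as)))            ≡⟨ cong (insertAll [] ∘ concat) (unfold-reverse a as) ⟩
  insertAll [] (concat (reverse as ∷ʳ a))             ≡⟨ cong (insertAll []) (sym (concat-++ (reverse as) (a ∷ []))) ⟩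
  insertAll [] (concat (reverse as) ++ (a ++ []))     ≡⟨ cong (λ z → insertAll [] (concat (reverse as) ++ z)) (++-identityʳ a) ⟩
  insertAll [] (concat (reverse as) ++ a)             ≡⟨ foldl-++ _ [] (concat (reverse as)) a ⟩
  insertAll (rect as) a                               ∎
  where open ≡-Reasoning

-- Rows that eventually grow like the rows of a periodic tableau

module Periodic (m K : ℕ) (1≤m : 1 ≤ m) where

  -- Equality of the increments from `t` to `suc t`, hence of the multiplicities of `suc t`, written
  -- crosswise to avoid subtraction. `K` will be the largest entry `k * m` of S^(k).
  record GrowsLike (P : ℕ) (r a : List ℕ) : Set where
    constructor growsLike
    field
      growth : ∀ {t} → P ≤ t → t < K →
        count (suc t) r + count t a ≡ count (suc t) a + count t r
  open GrowsLike

  -- The window of a′ is shifted by one because an entry only bumps strictly larger ones.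
  record Dominates (a a′ : List ℕ) : Set where
    constructor dominates
    field
      domination : ∀ {s} → m + s < K →
        count (suc (m + s)) a′ + count s a ≤ count (m + s) a + count (suc s) a′
  open Dominates

  growsLike-mono : ∀ {P Q r a} → P ≤ Q → GrowsLike P r a → GrowsLike Q r a
  growsLike-mono P≤Q g = growsLike λ Q≤t → growth g (≤-trans P≤Q Q≤t)

  growsLike-refl : ∀ {P} a → GrowsLike P a a
  growsLike-refl a = growsLike λ _ _ → refl

  -- The increments telescope; the counts at the intermediate point cancel.
  growsLike-+ : ∀ {P r a s} d → GrowsLike P r a → P ≤ s → d + s ≤ K →
    count (d + s) r + count s a ≡ count (d + s) a + count s r
  growsLike-+ {r = r} {a} {s} zero g P≤s _ = +-comm (count s r) (count s a)
  growsLike-+ {r = r} {a} {s} (suc d) g P≤s d+s<K =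
    +-cancelʳ-≡ (a₁ + r₁) _ _ (begin
      (r₂ + a₀) + (a₁ + r₁)  ≡⟨ solve 4 (λ p q u v → (p :+ q) :+ (u :+ v) := (p :+ u) :+ (v :+ q)) refl r₂ a₀ a₁ r₁ ⟩
      (r₂ + a₁) + (r₁ + a₀)  ≡⟨ cong₂ _+_ (growth g (≤-trans P≤s (m≤n+m s d)) d+s<K) (growsLike-+ d g P≤s (<⇒≤ d+s<K)) ⟩
      (a₂ + r₁) + (a₁ + r₀)  ≡⟨ solve 4 (λ p q u v → (p :+ u) :+ (v :+ q) := (p :+ q) :+ (v :+ u)) refl a₂ r₀ r₁ a₁ ⟩
      (a₂ + r₀) + (a₁ + r₁)  ∎)
    where
    open ≡-Reasoning
    r₀ = count s r
    r₁ = count (d + s) r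
    r₂ = count (suc d + s) r
    a₀ = count s a
    a₁ = count (d + s) a
    a₂ = count (suc d + s) a

  -- Domination compares increments over one period, and above `P` these are the same for `w`, `r`
  -- as for `a`, `a′`.
  growsLike-dominates : ∀ {P w r a a′ s} → GrowsLike P w a → GrowsLike P r a′ → Dominates a a′ →
    P ≤ s → m + s < K →
    count (suc (m + s)) r + count s w ≤ count (m + s) w + count (suc s) r
  growsLike-dominates {P} {w} {r} {a} {a′} {s} gw gr dom P≤s lt =
    +-cancelʳ-≤ (count s a + count (suc s) a′) _ _ (begin
      (r₂ + w₁) + (a₁ + a′₁)  ≡⟨ solve 4 (λ p q u v → (p :+ q) :+ (u :+ v) := (p :+ v) :+ (u :+ q)) refl r₂ w₁ a₁ a′₁ ⟩
      (r₂ + a′₁) + (a₁ + w₁)  ≡⟨ cong (_+ (a₁ + w₁)) gr′ ⟩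
      (a′₂ + r₁) + (a₁ + w₁)  ≡⟨ solve 4 (λ p q u v → (p :+ q) :+ (u :+ v) := (p :+ u) :+ (q :+ v)) refl a′₂ r₁ a₁ w₁ ⟩
      (a′₂ + a₁) + (r₁ + w₁)  ≤⟨ +-monoˡ-≤ (r₁ + w₁) (domination dom lt) ⟩
      (a₂ + a′₁) + (r₁ + w₁)  ≡⟨ solve 4 (λ p q u v → (p :+ q) :+ (u :+ v) := (p :+ v) :+ (q :+ u)) refl a₂ a′₁ r₁ w₁ ⟩
      (a₂ + w₁) + (a′₁ + r₁)  ≡⟨ cong (_+ (a′₁ + r₁)) (sym (growsLike-+ m gw P≤s (<⇒≤ lt))) ⟩
      (w₂ + a₁) + (a′₁ + r₁)  ≡⟨ solve 4 (λ p q u v → (p :+ q) :+ (u :+ v) := (p :+ v) :+ (q :+ u)) refl w₂ a₁ a′₁ r₁ ⟩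
      (w₂ + r₁) + (a₁ + a′₁)  ∎)
    where
    open ≤-Reasoning
    w₁ = count s w
    w₂ = count (m + s) w
    a₁ = count s a
    a₂ = count (m + s) a
    r₁ = count (suc s) r
    r₂ = count (suc (m + s)) r
    a′₁ = count (suc s) a′
    a′₂ = count (suc (m + s)) a′
    gr′ : r₂ + a′₁ ≡ a′₂ + r₁
    gr′ = subst (λ z → count z r + a′₁ ≡ count z a′ + r₁) (+-suc m s)
            (growsLike-+ m gr (m≤n⇒m≤1+n P≤s) (subst (_≤ K) (sym (+-suc m s)) lt))

  -- Survivors of one insertion

  module _ {P w r a a′ b v n}
           (gw : GrowsLike P w a) (gr : GrowsLike P r a′) (dom : Dominates a a′)
           (sw : Sorted w) (sr : Sorted r) (ins : Insertion w r b v n) where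

    -- If `suc t` survives, the entries bumped up to `suc t` are at least as many as the letters of
    -- `w` up to `t`. One period earlier, those bumped up to `suc s` were at most the letters up to
    -- `s`. Since `r` gains no more over the period than `w`, no new survivor fits in between.
    survivors-constant-+ : ∀ {s} → P ≤ s → m + s < K → count (suc (m + s)) v ≡ count (m + s) v
    survivors-constant-+ {s} P≤s lt =
      ≤-antisym (decrease (survives⇒all-matched t ins sw sr)) (count-mono v (n≤1+n t))
      where
      open ≤-Reasoning
      t = m + s
      decrease : count (suc t) v ≤ count t v ⊎ count t w ≤ count (suc t) b → count (suc t) v ≤ count t v
      decrease (inj₁ le) = le
      decrease (inj₂ le) = +-cancelˡ-≤ (count t w + count s w) _ _ (begin
        (count t w + count s w) + count (suc t) v        ≡⟨ solve 3 (λ p q u → (p :+ q) :+ u := (p :+ u) :+ q) refl (count t w) (count s w) (count (suc t) v) ⟩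
        (count t w + count (suc t) v) + count s w        ≤⟨ +-monoˡ-≤ (count s w) (+-monoˡ-≤ (count (suc t) v) le) ⟩
        (count (suc t) b + count (suc t) v) + count s w  ≡⟨ cong (_+ count s w) (sym (count-oldRow (suc t) ins)) ⟩
        count (suc t) r + count s w                      ≤⟨ growsLike-dominates gw gr dom P≤s lt ⟩
        count t w + count (suc s) r                      ≡⟨ cong (count t w +_) (count-oldRow (suc s) ins) ⟩
        -- Here `1 ≤ m` gives `suc s ≤ t`, so survivors up to `suc s` are counted by `t`.
        count t w + (count (suc s) b + count (suc s) v)  ≤⟨ +-monoʳ-≤ (count t w) (+-mono-≤ (bumped-matched s ins) (count-mono v (+-monoˡ-≤ s 1≤m))) ⟩
        count t w + (count s w + count t v)              ≡⟨ sym (+-assoc (count t w) (count s w) (count t v)) ⟩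
        (count t w + count s w) + count t v              ∎)

    survivors-constant : ∀ {t} → m + P ≤ t → t < K → count (suc t) v ≡ count t v
    survivors-constant {t} m+P≤t t<K =
      subst (λ z → count (suc z) v ≡ count z v) m+s≡t
        (survivors-constant-+ P≤s (subst (_< K) (sym m+s≡t) t<K))
      where
      m+s≡t : m + (t ∸ m) ≡ t
      m+s≡t = m+[n∸m]≡n (≤-trans (m≤m+n m P) m+P≤t)
      P≤s : P ≤ t ∸ m
      P≤s = +-cancelˡ-≤ m _ _ (subst (m + P ≤_) (sym m+s≡t) m+P≤t)

    -- Counts satisfy n = w + v and r = b + v. Once `v` is constant, `n` grows like `w` and, in the
    -- next lemma, `b` like `r`.
    newRow-growsLike : GrowsLike (m + P) n a
    newRow-growsLike = growsLike λ {t} le lt → begin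
      count (suc t) n + count t a                        ≡⟨ cong (_+ count t a) (count-newRow (suc t) ins) ⟩
      (count (suc t) w + count (suc t) v) + count t a    ≡⟨ cong (λ z → (count (suc t) w + z) + count t a) (survivors-constant le lt) ⟩
      (count (suc t) w + count t v) + count t a          ≡⟨ solve 3 (λ p q u → (p :+ q) :+ u := (p :+ u) :+ q) refl (count (suc t) w) (count t v) (count t a) ⟩
      (count (suc t) w + count t a) + count t v          ≡⟨ cong (_+ count t v) (growth gw (≤-trans (m≤n+m P m) le) lt) ⟩
      (count (suc t) a + count t w) + count t v          ≡⟨ +-assoc (count (suc t) a) (count t w) (count t v) ⟩
      count (suc t) a + (count t w + count t v)          ≡⟨ cong (count (suc t) a +_) (sym (count-newRow t ins)) ⟩
      count (suc t) a + count t n                        ∎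
      where open ≡-Reasoning

    bumped-growsLike : GrowsLike (m + P) b a′
    bumped-growsLike = growsLike λ {t} le lt → +-cancelʳ-≡ (count t v) _ _ (begin
      (count (suc t) b + count t a′) + count t v         ≡⟨ solve 3 (λ p q u → (p :+ q) :+ u := (p :+ u) :+ q) refl (count (suc t) b) (count t a′) (count t v) ⟩
      (count (suc t) b + count t v) + count t a′         ≡⟨ cong (λ z → (count (suc t) b + z) + count t a′) (sym (survivors-constant le lt)) ⟩
      (count (suc t) b + count (suc t) v) + count t a′   ≡⟨ cong (_+ count t a′) (sym (count-oldRow (suc t) ins)) ⟩
      count (suc t) r + count t a′                       ≡⟨ growth gr (≤-trans (m≤n+m P m) le) lt ⟩
      count (suc t) a′ + count t r                       ≡⟨ cong (count (suc t) a′ +_) (count-oldRow t ins) ⟩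
      count (suc t) a′ + (count t b + count t v)         ≡⟨ sym (+-assoc (count (suc t) a′) (count t b) (count t v)) ⟩
      (count (suc t) a′ + count t b) + count t v         ∎)
      where open ≡-Reasoning

  -- Row i of T grows like row i of the second tableau beyond P + i d; missing rows
  -- of T count as empty.
  Tracks : (d P : ℕ) → List (List ℕ) → List (List ℕ) → Set
  Tracks d P T []       = T ≡ []
  Tracks d P T (a ∷ as) =
    Sorted (firstRow T) × GrowsLike P (firstRow T) a × Tracks d (d + P) (otherRows T) as

  -- What an insertion loses: the thresholds P + i m become P + (i + 1) m, but the row
  -- created last keeps its P + l m, and all of them must lie below Q + i d.
  Allows : (l P d Q : ℕ) → Set
  Allows zero    P d Q = P ≤ Q
  Allows (suc l) P d Q = m + P ≤ Q × Allows l (m + P) d (d + Q)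

  -- Every row but the last uses its extra period exactly; the last has one to spare.
  allows-staircase : ∀ l {P} → Allows l P m (m + P)
  allows-staircase zero    {P} = m≤n+m P m
  allows-staircase (suc l)     = ≤-refl , allows-staircase l

  -- The largest threshold is P + l m, since the row created last loses no period.
  allows-uniform : ∀ l {P Q} → l * m + P ≤ Q → Allows l P 0 Q
  allows-uniform zero    le = le
  allows-uniform (suc l) {P} {Q} le = ≤-trans (+-monoʳ-≤ m (m≤n+m P (l * m))) le′ , allows-uniform l le″
    where
    le″ : l * m + (m + P) ≤ Q
    le″ = subst (_≤ Q) (solve 3 (λ p q u → (p :+ q) :+ u := q :+ (p :+ u)) refl m (l * m) P) le
    le′ : m + (l * m + P) ≤ Q
    le′ = subst (_≤ Q) (+-assoc m (l * m) P) le

  -- The bumped word is the word inserted into the remaining rows. It has lost one period, and the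
  -- next row of the staircase starts one period later, so the hypotheses recur with `m + P`.
  insertAll-tracks : ∀ {P d Q w a} T as → Sorted w → GrowsLike P w a → Linked Dominates (a ∷ as) →
    Tracks m P T as → Allows (length as) P d Q → Tracks d Q (insertAll T w) (a ∷ as)
  -- With no rows left, the word itself becomes the new row and its threshold is kept.
  insertAll-tracks {w = w} {a} .[] [] sw gw _ refl P≤Q =
      subst Sorted (sym first) sw
    , subst (λ z → GrowsLike _ z a) (sym first) (growsLike-mono P≤Q gw)
    , insertAll-otherRows [] append sw
    where
    first : firstRow (insertAll [] w) ≡ w
    first = insertAll-firstRow [] append sw
  insertAll-tracks {w = w} {a} T (a′ ∷ as) sw gw (dom ∷ doms) (sr , gr , tr) (le , al)
    with insertion w (firstRow T)
  ... | b , v , n , ins =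
      subst Sorted (sym first) (newRow-sorted ins sw sr)
    , subst (λ z → GrowsLike _ z a) (sym first)
        (growsLike-mono le (newRow-growsLike gw gr dom sw sr ins))
    , subst (λ z → Tracks _ _ z (a′ ∷ as)) (sym (insertAll-otherRows T ins sw))
        (insertAll-tracks (otherRows T) as (bumped-sorted ins sr)
          (bumped-growsLike gw gr dom sw sr ins) doms tr al)
    where
    first : firstRow (insertAll T w) ≡ n
    first = insertAll-firstRow T ins sw

  -- A row grows like itself from any threshold on, so that of the rows below can be taken for it.
  -- Each insertion into a nonempty tableau then shifts the staircase by one period.
  rect-tracks-staircase : ∀ a as → All Sorted (a ∷ as) → Linked Dominates (a ∷ as) →
    Tracks m (length as * m) (rect (a ∷ as)) (a ∷ as)
  rect-tracks-staircase a [] (sa ∷ _) dom =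
    subst (λ T → Tracks m 0 T (a ∷ [])) (sym (rect-∷ a []))
      (insertAll-tracks {P = 0} {d = m} [] [] sa (growsLike-refl a) dom refl z≤n)
  rect-tracks-staircase a (a′ ∷ as) (sa ∷ sas) dom =
    subst (λ T → Tracks m (m + length as * m) T (a ∷ a′ ∷ as)) (sym (rect-∷ a (a′ ∷ as)))
      (insertAll-tracks (rect (a′ ∷ as)) (a′ ∷ as) sa (growsLike-refl a) dom
        (rect-tracks-staircase a′ as sas (Linked.tail dom)) (allows-staircase (suc (length as))))

  -- Nothing is inserted after the top row, so a common bound for all thresholds replaces the
  -- staircase.
  rect-tracks-uniform : ∀ {Q} a a′ as → All Sorted (a ∷ a′ ∷ as) → Linked Dominates (a ∷ a′ ∷ as) →
    suc (length as) * m + length as * m ≤ Q → Tracks 0 Q (rect (a ∷ a′ ∷ as)) (a ∷ a′ ∷ as)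
  rect-tracks-uniform {Q} a a′ as (sa ∷ sas) dom le =
    subst (λ T → Tracks 0 Q T (a ∷ a′ ∷ as)) (sym (rect-∷ a (a′ ∷ as)))
      (insertAll-tracks (rect (a′ ∷ as)) (a′ ∷ as) sa (growsLike-refl a) dom
        (rect-tracks-staircase a′ as sas (Linked.tail dom)) (allows-uniform (suc (length as)) le))

  -- From growth to row indices

  growsLike-∈ : ∀ {Q r a t} → GrowsLike Q r a → Q ≤ t → t < K → Any (suc t ≡_) r → Any (suc t ≡_) a
  growsLike-∈ {r = r} {a} {t} g Q≤t t<K p = count<⇒∈ a (+-cancelʳ-< (count t r) _ _
    (subst₂ _<_ (+-comm (count t r) (count t a)) (growth g Q≤t t<K) (+-monoˡ-< (count t a) (∈⇒count< p))))

  growsLike-sym : ∀ {Q r a} → GrowsLike Q r a → GrowsLike Q a r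
  growsLike-sym g = growsLike λ Q≤t t<K → sym (growth g Q≤t t<K)

  tracks-rowIndex : ∀ {Q t} T as → Tracks 0 Q T as → Q ≤ t → t < K →
    rowIndex (suc t) T ≡ rowIndex (suc t) as
  tracks-rowIndex T [] refl _ _ = refl
  tracks-rowIndex {t = t} [] (a ∷ as) (_ , g , tr) Q≤t t<K with any? (suc t ≟_) a
  -- The missing row counts as empty, so it cannot share `suc t` with `a`.
  ... | yes p with () ← growsLike-∈ (growsLike-sym g) Q≤t t<K p
  ... | no _ = cong (Maybe.map suc) (tracks-rowIndex [] as tr Q≤t t<K)
  tracks-rowIndex {t = t} (r ∷ T) (a ∷ as) (_ , g , tr) Q≤t t<K with any? (suc t ≟_) r | any? (suc t ≟_) a
  ... | yes _ | yes _ = refl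
  ... | yes p | no ¬p = ⊥-elim (¬p (growsLike-∈ g Q≤t t<K p))
  ... | no ¬p | yes p = ⊥-elim (¬p (growsLike-∈ (growsLike-sym g) Q≤t t<K p))
  ... | no _  | no _  = cong (Maybe.map suc) (tracks-rowIndex T as tr Q≤t t<K)

-- The rows of S^(k)

block : ℕ → List ℕ → ℕ → List ℕ
block m R j = map (_+ (j * m)) R

powerRow : ℕ → ℕ → List ℕ → List ℕ
powerRow m k R = concat (map (block m R) (upTo k))

powerRow-applyUpTo : ∀ m k R → powerRow m k R ≡ concat (applyUpTo (block m R) k)
powerRow-applyUpTo m k R = cong concat (map-upTo (block m R) k)

InRange : ℕ → ℕ → Set
InRange m x = 1 ≤ x × x ≤ m

powerRow-sorted : ∀ {m R} k → Linked _<_ R → All (InRange m) R → Sorted (powerRow m k R)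
powerRow-sorted {m} {R} k incr range = subst Sorted (sym (powerRow-applyUpTo m k R))
  (AllPairs.concat⁺
    (All.applyUpTo⁺₂ (block m R) k λ j → AllPairs.map⁺
      (AllPairs.map (+-monoˡ-≤ (j * m) ∘ <⇒≤) (Linked.Linked⇒AllPairs <-trans incr)))
    (AllPairs.applyUpTo⁺₁ (block m R) k λ {i} {j} i<j _ →
      -- An entry of block `i` is at most `(i + 1) * m`, and an entry of a later block `j` is at
      -- least `j * m`.
      All.map⁺ (All.map (λ {x} (_ , x≤m) → All.map⁺ (All.map (λ {y} _ →
        ≤-trans (+-monoˡ-≤ (i * m) x≤m) (≤-trans (*-monoˡ-≤ m i<j) (m≤n+m (j * m) y))) range)) range)))

count-block-suc : ∀ m t R j → count (m + t) (block m R (suc j)) ≡ count t (block m R j)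
count-block-suc m t []      j = refl
count-block-suc m t (x ∷ R) j = cong₂ _+_ (cong (1 ∸_) shifted) (count-block-suc m t R j)
  where
  shifted : (x + (m + j * m)) ∸ (m + t) ≡ (x + j * m) ∸ t
  shifted = trans (cong (_∸ (m + t)) (solve 3 (λ p q u → p :+ (q :+ u) := q :+ (p :+ u)) refl x m (j * m)))
                  ([m+n]∸[m+o]≡n∸o m (x + j * m) t)

count-concat-applyUpTo : ∀ {t u} (f g : ℕ → List ℕ) k → (∀ j → count t (f j) ≡ count u (g j)) →
  count t (concat (applyUpTo f k)) ≡ count u (concat (applyUpTo g k))
count-concat-applyUpTo f g zero    eq = refl
count-concat-applyUpTo {t} {u} f g (suc k) eq =
  trans (count-++ t (f 0) _)
    (trans (cong₂ _+_ (eq 0) (count-concat-applyUpTo {t} {u} (f ∘ suc) (g ∘ suc) k (eq ∘ suc)))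
      (sym (count-++ u (g 0) _)))

-- The first block lies wholly below `m + t`; the other blocks are the translates by `m` of all
-- blocks but the last, and the last lies beyond `t`.
count-powerRow : ∀ {m R t} k → 1 ≤ m → All (InRange m) R → m + t ≤ k * m →
  count (m + t) (powerRow m k R) ≡ length R + count t (powerRow m k R)
count-powerRow {m} {R} {t} zero 1≤m _ le = ⊥-elim (<⇒≱ 1≤m (≤-trans (m≤m+n m t) le))
count-powerRow {m} {R} {t} (suc k) _ range le = begin
  count (m + t) (powerRow m (suc k) R)                          ≡⟨ cong (count (m + t)) (powerRow-applyUpTo m (suc k) R) ⟩
  count (m + t) (B 0 ++ concat (applyUpTo (B ∘ suc) k))         ≡⟨ count-++ (m + t) (B 0) _ ⟩
  count (m + t) (B 0) + count (m + t) (concat (applyUpTo (B ∘ suc) k))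
    ≡⟨ cong₂ _+_ first (count-concat-applyUpTo {m + t} {t} (B ∘ suc) B k (count-block-suc m t R)) ⟩
  length R + count t (concat (applyUpTo B k))                   ≡⟨ cong (length R +_) (sym last) ⟩
  length R + count t (powerRow m (suc k) R)                     ∎
  where
  open ≡-Reasoning
  B : ℕ → List ℕ
  B = block m R
  first : count (m + t) (B 0) ≡ length R
  first = trans (count-all (All.map⁺ (All.map (λ {x} (_ , x≤m) →
            subst (_≤ m + t) (sym (+-identityʳ x)) (≤-trans x≤m (m≤m+n m t))) range)))
          (length-map _ R)
  last-block : count t (B k) ≡ 0
  last-block = count-none (All.map⁺ (All.map (λ (1≤x , _) →
    +-mono-≤ 1≤x (+-cancelˡ-≤ m _ _ le)) range))
  last : count t (powerRow m (suc k) R) ≡ count t (concat (applyUpTo B k))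
  last = begin
    count t (powerRow m (suc k) R)                      ≡⟨ cong (count t) (powerRow-applyUpTo m (suc k) R) ⟩
    count t (concat (applyUpTo B (suc k)))              ≡⟨ cong (count t ∘ concat) (sym (applyUpTo-∷ʳ B k)) ⟩
    count t (concat (applyUpTo B k ∷ʳ B k))             ≡⟨ cong (count t) (sym (concat-++ (applyUpTo B k) (B k ∷ []))) ⟩
    count t (concat (applyUpTo B k) ++ (B k ++ []))     ≡⟨ count-++ t (concat (applyUpTo B k)) _ ⟩
    count t (concat (applyUpTo B k)) + count t (B k ++ [])
      ≡⟨ cong (λ z → count t (concat (applyUpTo B k)) + count t z) (++-identityʳ (B k)) ⟩
    count t (concat (applyUpTo B k)) + count t (B k)    ≡⟨ cong (count t (concat (applyUpTo B k)) +_) last-block ⟩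
    count t (concat (applyUpTo B k)) + 0                ≡⟨ +-identityʳ _ ⟩
    count t (concat (applyUpTo B k))                    ∎

module _ {m : ℕ} (k : ℕ) (1≤m : 1 ≤ m) where
  open Periodic m (k * m) 1≤m

  -- A window of `m` values contains `length R` entries of the row wherever it starts, so the shift
  -- by one is harmless and the row sizes decide.
  powerRow-dominates : ∀ {R R′} → All (InRange m) R → All (InRange m) R′ → length R′ ≤ length R →
    Dominates (powerRow m k R) (powerRow m k R′)
  powerRow-dominates {R} {R′} range range′ shorter = dominates λ {s} lt → begin
    count (suc (m + s)) a′ + count s a               ≡⟨ cong (λ z → count z a′ + count s a) (sym (+-suc m s)) ⟩
    count (m + suc s) a′ + count s a                 ≡⟨ cong (_+ count s a) (count-powerRow k 1≤m range′ (subst (_≤ k * m) (sym (+-suc m s)) lt)) ⟩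
    (length R′ + count (suc s) a′) + count s a       ≤⟨ +-monoˡ-≤ (count s a) (+-monoˡ-≤ (count (suc s) a′) shorter) ⟩
    (length R + count (suc s) a′) + count s a        ≡⟨ solve 3 (λ p q u → (p :+ q) :+ u := (p :+ u) :+ q) refl (length R) (count (suc s) a′) (count s a) ⟩
    (length R + count s a) + count (suc s) a′        ≡⟨ cong (_+ count (suc s) a′) (sym (count-powerRow k 1≤m range (<⇒≤ lt))) ⟩
    count (m + s) a + count (suc s) a′               ∎
    where
    open ≤-Reasoning
    a  = powerRow m k R
    a′ = powerRow m k R′

  powerRows-dominate : ∀ {Rs} → All (All (InRange m)) Rs → Linked (λ R R′ → length R′ ≤ length R) Rs →
    Linked Dominates (map (powerRow m k) Rs)
  powerRows-dominate _ [] = []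
  powerRows-dominate _ [-] = [-]
  powerRows-dominate (p ∷ q ∷ ps) (le ∷ les) = powerRow-dominates p q le ∷ powerRows-dominate (q ∷ ps) les

-- Standard skew tableaux and the bound 2b - 2

rows-power : ∀ S k → map proj₂ (power S k) ≡ map (powerRow (size S) k) (map proj₂ S)
rows-power S k = trans (sym (map-∘ S)) (map-∘ S)

standard-inRange : ∀ {S} → IsStandardSkew S → All (All (InRange (size S))) (map proj₂ S)
standard-inRange {S} (_ , _ , perm) = All.concat⁻ (All-resp-↭ (↭-sym perm)
  (All.map⁺ (All.map (λ i<m → s≤s z≤n , i<m) (All.all-upTo (size S)))))

theorem1p5 : (b : ℕ) → 2 ≤ b → (S : SkewTableau) →
    IsStandardSkew S → length S ≡ b → AllRowsNonempty S →
    RowSizesWeaklyDecreasing S →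
    StabilizesAt S (2 * b ∸ 2)
theorem1p5 _ (s≤s ()) (_ ∷ []) _ refl _ _
-- Writing the entry as `suc t` turns its range into `(k ∸ 1) * size S ≤ t < k * size S`.
theorem1p5 _ _ S@(R₁ ∷ R₂ ∷ Rs) std@(incr , _) refl (1≤R₁ ∷ _) decr (suc t) (s≤s Q≤t) t<K =
  trans (cong (rowIndex (suc t) ∘ rect) (rows-power S k))
    (trans (tracks-rowIndex (rect as) as tracks Q≤t t<K)
      (cong (rowIndex (suc t)) (sym (rows-power S k))))
  where
  m k : ℕ
  m = size S
  k = 2 * length S ∸ 2
  as : List (List ℕ)
  as = map (powerRow m k) (map proj₂ S)
  range : All (All (InRange m)) (map proj₂ S)
  range = standard-inRange {S} std
  1≤m : 1 ≤ m
  1≤m = ≤-trans 1≤R₁ (subst (rowSize R₁ ≤_) (sym (length-++ (proj₂ R₁))) (m≤m+n _ _))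
  open Periodic m (k * m) 1≤m
  sorted : All Sorted as
  sorted = All.map⁺ (All.zipWith (λ (i , r) → powerRow-sorted k i r) (All.map⁺ incr , range))
  L : ℕ
  L = length (map (powerRow m k) (map proj₂ Rs))
  L≡ : L ≡ length Rs
  L≡ = trans (length-map _ (map proj₂ Rs)) (length-map proj₂ Rs)
  -- With L = b - 2 this is an equality: (2L + 1) m = (2b - 3) m. In the chain below, `k` reduces to
  -- `l + suc (suc (l + 0))`.
  threshold : suc L * m + L * m ≤ (k ∸ 1) * m
  threshold = ≤-reflexive (trans (sym (*-distribʳ-+ m (suc L) L)) (cong (_* m) (begin
    suc L + L                        ≡⟨ cong₂ (λ p q → suc p + q) L≡ L≡ ⟩
    suc (l + l)                      ≡⟨ sym (+-suc l l) ⟩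
    l + suc l                        ≡⟨ cong (λ z → (l + suc z)) (sym (+-identityʳ l)) ⟩
    l + suc (l + 0)                  ≡⟨ sym (cong (_∸ 1) (+-suc l (suc (l + 0)))) ⟩
    k ∸ 1                            ∎)))
    where
    open ≡-Reasoning
    l = length Rs
  tracks : Tracks 0 ((k ∸ 1) * m) (rect as) as
  tracks = rect-tracks-uniform _ _ _ sorted
    (powerRows-dominate k 1≤m range (Linked.map⁺ decr)) threshold
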